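{- Let $G$ be a fixed edge-ordered graph with minimal edge $e_0$. If $e_0$ is isolated in $G$, then either $sat_m(n,G)=O(1)$ or $sat_m(n,G)=\Theta(n)$. Otherwise, if $e_0$ is not isolated, then $sat_m(n,G)=\Omega(n)$.
   Context: An edge-ordered graph is a finite simple graph together with a linear order on its edge set (usually given by an injective labeling $l:E\to\mathbb{N}$ or $l:E\to\mathbb{R}$). An edge-ordered graph $H$ contains $G$ (has a copy of $G$) if $G$ is isomorphic, by an isomorphism respecting the edge-order, to a subgraph of $H$ with the induced order; otherwise $H$ is $G$-free. The minimal edge $e_0$ of $G$ is the edge with the smallest label; an edge is isolated if it shares no vertex with any other edge. $sat_m(n,G)$ is the minimum number of edges in a $G$-free edge-ordered graph $H$ on $n$ vertices such that adding to $H$ any missing edge, inserted at the beginning of the linear order (i.e. with a label smaller than all labels of $H$), creates a copy of $G$. Asymptotic notation is for $n\to\infty$ with $G$ fixed ($n$ is assumed large enough). -}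

module Defs where

open import Data.Fin.Base as Fin using (Fin; zero; suc; combine)
import Data.Fin.Properties as Fin
open import Data.List.Base using (List; []; _∷_; length; lookup; head)
open import Data.List.Membership.Propositional using (_∈_; _∉_)
import Data.List.Membership.DecPropositional as DecMembership
open import Data.List.Membership.Propositional.Properties using (∈-lookup)
open import Data.List.Relation.Binary.Sublist.Heterogeneous as Sublist using (Sublist)
import Data.List.Relation.Binary.Sublist.Heterogeneous.Properties as Sublist
import Data.List.Relation.Unary.All as All
open import Data.List.Relation.Unary.All.Properties using (¬Any⇒All¬)
open import Data.List.Relation.Unary.AllPairs using ([]; _∷_; allPairs?)
open import Data.List.Relation.Unary.Unique.Propositional using (Unique)
open import Data.Maybe.Base using (just)
open import Data.Nat.Base using (ℕ; zero; suc; _≤_; _<_; _≥_; _*_; z≤n; s≤s)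
open import Data.Nat.Induction using (<-rec)
import Data.Nat.Properties as ℕ
open import Data.Product using (Σ; ∃; ∃₂; _×_; _,_; proj₁; proj₂)
open import Data.Sum.Base using (_⊎_; inj₁; inj₂)
import Data.Vec.Functional as Vector
open import Function.Base using (_∘_)
open import Function.Definitions using (Injective)
open import Relation.Binary.Definitions using (DecidableEquality)
open import Relation.Binary.PropositionalEquality
  using (_≡_; _≢_; _≗_; refl; sym; trans; cong; subst; subst₂)
open import Relation.Nullary.Decidable
  using (Dec; yes; no; map′; ¬?; _×-dec_; _⊎-dec_; _→-dec_; decidable-stable)
open import Relation.Nullary.Negation using (¬_; contradiction)

private
  variable
    k n : ℕ

-- An unordered pair of distinct vertices, listed with the smaller one first.
record Edge (n : ℕ) : Set where
  constructor edge
  field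
    lo hi : Fin n
    lo<hi : lo Fin.< hi

open Edge public

_endpointOf_ : Fin n → Edge n → Set
v endpointOf e = v ≡ lo e ⊎ v ≡ hi e

_joins_and_ : Edge n → Fin n → Fin n → Set
e joins u and v = (lo e ≡ u × hi e ≡ v) ⊎ (lo e ≡ v × hi e ≡ u)

-- A simple graph on Fin n with a linear order on its edges: the edges are
-- enumerated without repetition, in increasing order.
record EdgeOrderedGraph (n : ℕ) : Set where
  constructor mkGraph
  field
    edges    : List (Edge n)
    distinct : Unique edges

open EdgeOrderedGraph public

size : EdgeOrderedGraph n → ℕ
size H = length (edges H)

insertFirst : (H : EdgeOrderedGraph n) (e : Edge n) → e ∉ edges H →
              EdgeOrderedGraph n
insertFirst H e e∉H = mkGraph (e ∷ edges H) (¬Any⇒All¬ _ e∉H ∷ distinct H)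

MinimalEdge : EdgeOrderedGraph n → Edge n → Set
MinimalEdge G e = head (edges G) ≡ just e

Isolated : EdgeOrderedGraph n → Edge n → Set
Isolated G e = ∀ e′ → e′ ∈ edges G → e′ ≢ e →
               ∀ v → v endpointOf e → ¬ (v endpointOf e′)

-- φ maps the edges of G, in their order, onto a subsequence of the edges of H.
IsCopy : EdgeOrderedGraph k → EdgeOrderedGraph n → (Fin k → Fin n) → Set
IsCopy G H φ =
  Injective _≡_ _≡_ φ ×
  Sublist (λ e e′ → e′ joins φ (lo e) and φ (hi e)) (edges G) (edges H)

_Contains_ : EdgeOrderedGraph n → EdgeOrderedGraph k → Set
H Contains G = ∃ (IsCopy G H)

Saturated : EdgeOrderedGraph k → EdgeOrderedGraph n → Set
Saturated G H =
  ¬ (H Contains G) ×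
  (∀ e (e∉H : e ∉ edges H) → insertFirst H e e∉H Contains G)

SaturatedSize : EdgeOrderedGraph k → (n m : ℕ) → Set
SaturatedSize G n m = Σ (EdgeOrderedGraph n) λ H → Saturated G H × size H ≡ m

IsMinimum : (ℕ → Set) → ℕ → Set
IsMinimum P m = P m × (∀ m′ → P m′ → m ≤ m′)

_≟ᴱ_ : DecidableEquality (Edge n)
edge a b p ≟ᴱ edge c d q with a Fin.≟ c | b Fin.≟ d
... | yes refl | yes refl = yes (cong (edge a b) (ℕ.<-irrelevant p q))
... | no a≢c   | _        = no (a≢c ∘ cong lo)
... | yes _    | no b≢d   = no (b≢d ∘ cong hi)

_∈?_ : (e : Edge n) (es : List (Edge n)) → Dec (e ∈ es)
_∈?_ = DecMembership._∈?_ _≟ᴱ_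

anyEdge? : {P : Edge n → Set} → (∀ e → Dec (P e)) → Dec (∃ P)
anyEdge? {n} {P} P? =
  map′ (λ (a , b , p , x) → edge a b p , x)
       (λ (edge a b p , x) → a , b , p , x)
       (Fin.any? λ a → Fin.any? λ b → lohi? a b)
  where
  lohi? : (a b : Fin n) → Dec (Σ (a Fin.< b) λ p → P (edge a b p))
  lohi? a b with a Fin.<? b
  ... | no a≮b = no (a≮b ∘ proj₁)
  ... | yes p  = map′ (p ,_)
    (λ (q , x) → subst (P ∘ edge a b) (ℕ.<-irrelevant q p) x)
    (P? (edge a b p))

allEdges? : {P : Edge n → Set} → (∀ e → Dec (P e)) → Dec (∀ e → P e)
allEdges? P? with anyEdge? (¬? ∘ P?)
... | yes (e , ¬Pe) = no (λ all → ¬Pe (all e))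
... | no ¬∃         = yes (λ e → decidable-stable (P? e) (λ ¬Pe → ¬∃ (e , ¬Pe)))

anyEdgeList? : ∀ m {P : List (Edge n) → Set} → (∀ es → Dec (P es)) →
               Dec (∃ λ es → length es ≡ m × P es)
anyEdgeList? zero    P? =
  map′ (λ x → [] , refl , x) (λ { ([] , _ , x) → x }) (P? [])
anyEdgeList? (suc m) P? =
  map′ (λ { (e , es , refl , x) → e ∷ es , refl , x })
       (λ { (e ∷ es , refl , x) → e , es , refl , x })
       (anyEdge? λ e → anyEdgeList? m λ es → P? (e ∷ es))

anyMap? : ∀ k {P : (Fin k → Fin n) → Set} →
          (∀ {φ ψ} → φ ≗ ψ → P φ → P ψ) → (∀ φ → Dec (P φ)) → Dec (∃ P)
anyMap? zero    resp P? = map′ (_ ,_) (λ (φ , x) → resp (λ ()) x) (P? λ ())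
anyMap? (suc k) resp P? =
  map′ (λ (x , φ , p) → x Vector.∷ φ , p)
       (λ (φ , p) → φ zero , φ ∘ suc , resp (λ { zero → refl ; (suc _) → refl }) p)
       (Fin.any? λ x → anyMap? k
         (λ φ≗ψ → resp λ { zero → refl ; (suc i) → φ≗ψ i })
         (λ φ → P? (x Vector.∷ φ)))

isCopy-resp : (G : EdgeOrderedGraph k) (H : EdgeOrderedGraph n) →
              ∀ {φ ψ} → φ ≗ ψ → IsCopy G H φ → IsCopy G H ψ
isCopy-resp G H φ≗ψ (inj , sub) =
  (λ {x} {y} eq → inj (trans (φ≗ψ x) (trans eq (sym (φ≗ψ y))))) ,
  Sublist.map (λ {e} {e′} → subst₂ (e′ joins_and_) (φ≗ψ (lo e)) (φ≗ψ (hi e))) sub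

isCopy? : (G : EdgeOrderedGraph k) (H : EdgeOrderedGraph n) →
          ∀ φ → Dec (IsCopy G H φ)
isCopy? G H φ = injective? ×-dec Sublist.sublist? joins? (edges G) (edges H)
  where
  injective? : Dec (Injective _≡_ _≡_ φ)
  injective? = map′ (λ f {x} {y} → f x y) (λ f x y → f {x} {y})
    (Fin.all? λ x → Fin.all? λ y → (φ x Fin.≟ φ y) →-dec (x Fin.≟ y))

  joins? : ∀ e e′ → Dec (e′ joins φ (lo e) and φ (hi e))
  joins? e e′ =
    ((lo e′ Fin.≟ φ (lo e)) ×-dec (hi e′ Fin.≟ φ (hi e))) ⊎-dec
    ((lo e′ Fin.≟ φ (hi e)) ×-dec (hi e′ Fin.≟ φ (lo e)))

contains? : (H : EdgeOrderedGraph n) (G : EdgeOrderedGraph k) → Dec (H Contains G)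
contains? {k = k} H G = anyMap? k (isCopy-resp G H) (isCopy? G H)

saturated? : (G : EdgeOrderedGraph k) (H : EdgeOrderedGraph n) → Dec (Saturated G H)
saturated? G H = ¬? (contains? H G) ×-dec allEdges? missing?
  where
  missing? : ∀ e → Dec (∀ (e∉H : e ∉ edges H) → insertFirst H e e∉H Contains G)
  missing? e with e ∈? edges H
  ... | yes e∈H = yes (λ e∉H → contradiction e∈H e∉H)
  ... | no e∉H  = map′ (λ c _ → c) (λ f → f e∉H) (contains? (insertFirst H e e∉H) G)

saturatedSize? : (G : EdgeOrderedGraph k) → ∀ n m → Dec (SaturatedSize G n m)
saturatedSize? G n m =
  map′ (λ (es , eq , u , s) → mkGraph es u , s , eq)
       (λ (mkGraph es u , s , eq) → es , eq , u , s)
       (anyEdgeList? m λ es → distinctSaturated? es)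
  where
  distinctSaturated? : (es : List (Edge n)) →
                       Dec (Σ (Unique es) λ u → Saturated G (mkGraph es u))
  distinctSaturated? es with allPairs? (λ e e′ → ¬? (e ≟ᴱ e′)) es
  ... | no ¬u = no (¬u ∘ proj₁)
  ... | yes u = map′ (u ,_) proj₂ (saturated? G (mkGraph es u))

lookup-injective : {es : List (Edge n)} → Unique es → Injective _≡_ _≡_ (lookup es)
lookup-injective (_ ∷ _) {zero}  {zero}  _  = refl
lookup-injective (d ∷ _) {zero}  {suc j} eq =
  contradiction eq (All.lookup d (∈-lookup j))
lookup-injective (d ∷ _) {suc i} {zero}  eq =
  contradiction (sym eq) (All.lookup d (∈-lookup i))
lookup-injective (_ ∷ u) {suc i} {suc j} eq = cong suc (lookup-injective u eq)

size≤n*n : (H : EdgeOrderedGraph n) → size H ≤ n * n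
size≤n*n {n} H = Fin.injective⇒≤ {f = code ∘ lookup (edges H)}
  (lookup-injective (distinct H) ∘ code-injective)
  where
  code : Edge n → Fin (n * n)
  code e = combine (lo e) (hi e)

  code-injective : Injective _≡_ _≡_ code
  code-injective {edge a b p} {edge c d q} eq
    with refl , refl ← Fin.combine-injective a b c d eq
    = cong (edge a b) (ℕ.<-irrelevant p q)

minimum : {P : ℕ → Set} → (∀ m → Dec (P m)) → ∃ P → ∃ (IsMinimum P)
minimum {P} P? (m , Pm) = <-rec (λ m → P m → ∃ (IsMinimum P)) step m Pm
  where
  step : ∀ m → (∀ {i} → i < m → P i → ∃ (IsMinimum P)) →
         P m → ∃ (IsMinimum P)
  step m rec Pm with ℕ.anyUpTo? P? m
  ... | yes (i , i<m , Pi) = rec i<m Pi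
  ... | no ¬∃ = m , Pm , λ i Pi → ℕ.≮⇒≥ (λ i<m → ¬∃ (i , i<m , Pi))

abstract
  minimumSaturatedSize : (G : EdgeOrderedGraph k) → ∀ {e₀} → MinimalEdge G e₀ →
                         ∀ n → ∃ (IsMinimum (SaturatedSize G n))
  minimumSaturatedSize G min n = minimum (saturatedSize? G n) saturatedSize
    where
    empty-free : (G : EdgeOrderedGraph k) → ∀ {e₀} → MinimalEdge G e₀ →
                 ¬ (mkGraph {n} [] [] Contains G)
    empty-free (mkGraph (_ ∷ _) _) _ (_ , _ , ())

    greedy : ∀ j → ∃ (SaturatedSize G n) ⊎
                   (Σ (EdgeOrderedGraph n) λ H → ¬ (H Contains G) × j ≤ size H)
    greedy zero = inj₂ (mkGraph [] [] , empty-free G min , z≤n)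
    greedy (suc j) with greedy j
    ... | inj₁ sat = inj₁ sat
    ... | inj₂ (H , free , j≤) with anyEdge? {P = Addable} addable?
      where
      Addable : Edge n → Set
      Addable e = Σ (e ∉ edges H) λ e∉H → ¬ (insertFirst H e e∉H Contains G)

      addable? : ∀ e → Dec (Addable e)
      addable? e with e ∈? edges H
      ... | yes e∈H = no (λ (e∉H , _) → e∉H e∈H)
      ... | no e∉H  = map′ (e∉H ,_) proj₂ (¬? (contains? (insertFirst H e e∉H) G))
    ...   | yes (e , e∉H , free′) = inj₂ (insertFirst H e e∉H , free′ , s≤s j≤)
    ...   | no ¬addable = inj₁ (size H , H , (free , λ e e∉H →
              decidable-stable (contains? (insertFirst H e e∉H) G)
                (λ free′ → ¬addable (e , e∉H , free′))) , refl)

    saturatedSize : ∃ (SaturatedSize G n)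
    saturatedSize with greedy (suc (n * n))
    ... | inj₁ sat         = sat
    ... | inj₂ (H , _ , n*n<) = contradiction (size≤n*n H) (ℕ.<⇒≱ n*n<)

-- If G has no edges, no large graph is G-free; the minimal edge rules this out.
satₘ : (G : EdgeOrderedGraph k) → ∀ {e₀} → MinimalEdge G e₀ → ℕ → ℕ
satₘ G min n = proj₁ (minimumSaturatedSize G min n)

satₘ-isMinimum : (G : EdgeOrderedGraph k) → ∀ {e₀} (min : MinimalEdge G e₀) →
                 ∀ n → IsMinimum (SaturatedSize G n) (satₘ G min n)
satₘ-isMinimum G min n = proj₂ (minimumSaturatedSize G min n)

-- For functions into ℕ, natural constants suffice: a lower bound f ≥ c g with
-- real c > 0 is g ≤ C f for any natural C ≥ 1 / c.
_∈O_ _∈Ω_ _∈Θ_ : (f g : ℕ → ℕ) → Set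
f ∈O g = ∃₂ λ C N → ∀ n → n ≥ N → f n ≤ C * g n
f ∈Ω g = g ∈O f
f ∈Θ g = f ∈O g × f ∈Ω g

{-# OPTIONS --safe #-}

-- A new first edge creates a copy of G only as the image of e₀. If e₀ is not isolated, two isolated
-- vertices of a saturated H cannot be joined, so H has at most one isolated vertex and linearly many edges.
--
-- Let e₀ be isolated. Then a new edge creates a copy of G as soon as some copy of G − e₀ avoids both its
-- ends. Starting from one copy of G − e₀ and adding edges greedily, only edges meeting that copy are added,
-- so sat = O(n). If some saturated H has an isolated vertex, every vertex of H is avoided by a copy of
-- G − e₀; boundedly many of these copies already have that property, and a greedy closure of their union,
-- on any number of vertices, adds edges only inside it, so sat = O(1). Otherwise n ≤ 2 sat(n).
-- As the bound in the O(1) case depends on k alone, one value of sat decides between the two.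
module Submission where

open import Defs
open import Data.Fin.Base as Fin using (Fin; zero; suc; toℕ; fromℕ<; inject≤; punchIn; punchOut; combine; remQuot)
import Data.Fin.Properties as Fin
open import Data.List.Base using (List; []; _∷_; length; lookup; tabulate; allFin)
open import Data.List.Membership.Propositional using (_∈_; _∉_; find)
import Data.List.Membership.DecPropositional as DecMembership
open import Data.List.Membership.Propositional.Properties using (∈-lookup; ∈-tabulate⁺; ∈-allFin)
open import Data.List.Properties using (length-tabulate)
open import Data.List.Relation.Binary.Sublist.Heterogeneous as Sublist using (Sublist; []; _∷_; _∷ʳ_)
import Data.List.Relation.Binary.Sublist.Heterogeneous.Properties as Sublist
open import Data.List.Relation.Unary.All as All using (All; []; _∷_)
open import Data.List.Relation.Unary.AllPairs using ([]; _∷_)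
open import Data.List.Relation.Unary.Any as Any using (Any; here; there; index)
open import Data.List.Relation.Unary.Any.Properties using (lookup-index)
open import Data.List.Relation.Unary.Unique.Propositional using (Unique)
open import Data.Nat.Base using (ℕ; zero; suc; _≤_; _<_; _+_; _*_; z≤n; s≤s)
import Data.Nat.Properties as ℕ
open import Data.Product using (Σ; ∃; ∃₂; _×_; _,_; proj₁; proj₂)
open import Data.Sum.Base using (_⊎_; inj₁; inj₂)
open import Data.Unit.Base using (⊤; tt)
open import Data.Vec.Functional using (updateAt)
open import Data.Vec.Functional.Properties using (updateAt-updates; updateAt-minimal)
open import Function.Base using (_∘_; id; const)
open import Function.Definitions using (Injective)
open import Relation.Binary.Definitions using (tri<; tri≈; tri>)
open import Relation.Binary.PropositionalEquality
  using (_≡_; _≢_; refl; sym; trans; cong; subst; subst₂; ≢-sym)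
open import Relation.Nullary.Decidable using (Dec; yes; no; ¬?; _×-dec_; _⊎-dec_; map′; decidable-stable)
open import Relation.Nullary.Negation using (¬_; contradiction)
open import Relation.Unary using (Decidable)

private
  variable
    k m n : ℕ

-- Fresh vertices and extension of injections.

module _ {n : ℕ} where
  open DecMembership (Fin._≟_ {n}) public using () renaming (_∈?_ to _∈ᶠ?_)

InjectiveOn : {A B : Set} → (A → Set) → (A → B) → Set
InjectiveOn P f = ∀ {x y} → P x → P y → f x ≡ f y → x ≡ y

-- Pigeonhole: if `xs` covered `Fin n`, positions in `xs` would inject `Fin n` into
-- `Fin (length xs)`.
fresh : (xs : List (Fin n)) → length xs < n → ∃ (_∉ xs)
fresh xs |xs|<n with Fin.any? (λ v → ¬? (v ∈ᶠ? xs))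
... | yes found = found
... | no ¬∃ = contradiction (Fin.injective⇒≤ index-injective) (ℕ.<⇒≱ |xs|<n)
  where
  covered : ∀ v → v ∈ xs
  covered v = decidable-stable (v ∈ᶠ? xs) (λ v∉ → ¬∃ (v , v∉))

  index-injective : Injective _≡_ _≡_ (λ v → index (covered v))
  index-injective {u} {v} eq = trans (lookup-index (covered u))
    (trans (cong (lookup xs) eq) (sym (lookup-index (covered v))))

-- With `j` left out, `f` takes at most k - 1 values, so `k ≤ n` is enough room.
freshFor : k ≤ n → (f : Fin k → Fin n) (j : Fin k) → ∃ λ v → ∀ i → i ≢ j → f i ≢ v
freshFor {suc k} k<n f j
  with v , v∉ ← fresh (tabulate (f ∘ punchIn j)) (subst (_< _) (sym (length-tabulate (f ∘ punchIn j))) k<n)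
  = v , λ i i≢j fi≡v → v∉ (subst (_∈ tabulate (f ∘ punchIn j))
      (trans (cong f (Fin.punchIn-punchOut (≢-sym i≢j))) fi≡v)
      (∈-tabulate⁺ {f = f ∘ punchIn j} (punchOut (≢-sym i≢j))))

extendInjection : {P : Fin k → Set} → Decidable P → (f : Fin k → Fin n) →
                  InjectiveOn P f → k ≤ n →
                  ∃ λ g → Injective _≡_ _≡_ g × (∀ {i} → P i → g i ≡ f i)
extendInjection {k} {n} {P} P? f inj k≤n =
  let g , inj′ , agree = extend (allFin k)
  in g , inj′ (inj₂ (∈-allFin _)) (inj₂ (∈-allFin _)) , agree
  where
  -- Indices outside `P` are re-placed one at a time. Each new value differs from every other
  -- current value, so injectivity on `P` and the indices treated so far is kept.
  extend : ∀ js → ∃ λ g → InjectiveOn (λ i → P i ⊎ i ∈ js) g × (∀ {i} → P i → g i ≡ f i)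
  extend [] = f , (λ { (inj₁ p) (inj₁ q) → inj p q }) , λ _ → refl
  extend (j ∷ js) with extend js | P? j
  ... | g , inj′ , agree | yes Pj = g , (λ p q → inj′ (drop p) (drop q)) , agree
    where
    drop : ∀ {i} → P i ⊎ i ∈ (j ∷ js) → P i ⊎ i ∈ js
    drop (inj₁ p)             = inj₁ p
    drop (inj₂ (here refl))   = inj₁ Pj
    drop (inj₂ (there i∈js))  = inj₂ i∈js
  ... | g , inj′ , agree | no ¬Pj with v , v-new ← freshFor k≤n g j
    = h , injective , λ {i} p → trans (h-other i λ { refl → ¬Pj p }) (agree p)
    where
    h : Fin k → Fin n
    h = updateAt g j (const v)

    h-j : h j ≡ v
    h-j = updateAt-updates j g

    h-other : ∀ i → i ≢ j → h i ≡ g i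
    h-other i = updateAt-minimal i j g

    drop : ∀ {i} → i ≢ j → P i ⊎ i ∈ (j ∷ js) → P i ⊎ i ∈ js
    drop i≢j (inj₁ p)            = inj₁ p
    drop i≢j (inj₂ (here i≡j))   = contradiction i≡j i≢j
    drop i≢j (inj₂ (there i∈js)) = inj₂ i∈js

    injective : InjectiveOn (λ i → P i ⊎ i ∈ (j ∷ js)) h
    injective {x} {y} p q eq with x Fin.≟ j | y Fin.≟ j
    ... | yes refl | yes refl = refl
    ... | yes refl | no y≢j =
      contradiction (trans (sym (h-other y y≢j)) (trans (sym eq) h-j)) (v-new y y≢j)
    ... | no x≢j | yes refl =
      contradiction (trans (sym (h-other x x≢j)) (trans eq h-j)) (v-new x x≢j)
    ... | no x≢j | no y≢j =
      inj′ (drop x≢j p) (drop y≢j q) (trans (sym (h-other x x≢j)) (trans eq (h-other y y≢j)))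

-- Sublists, edges and their ends.

Sublist-map∈ : {A B : Set} {R S : A → B → Set} {as : List A} {bs : List B} →
               (∀ {a b} → a ∈ as → R a b → S a b) → Sublist R as bs → Sublist S as bs
Sublist-map∈ f []        = []
Sublist-map∈ f (b ∷ʳ rs) = b ∷ʳ Sublist-map∈ f rs
Sublist-map∈ f (r ∷ rs)  = f (here refl) r ∷ Sublist-map∈ (f ∘ there) rs

Sublist-image : {A B : Set} {R : A → B → Set} {as : List A} {bs : List B} {a : A} →
                Sublist R as bs → a ∈ as → ∃ λ b → b ∈ bs × R a b
Sublist-image (_ ∷ʳ rs) a∈ with b , b∈ , r ← Sublist-image rs a∈ = b , there b∈ , r
Sublist-image (r ∷ rs) (here refl) = _ , here refl , r
Sublist-image (r ∷ rs) (there a∈) with b , b∈ , r′ ← Sublist-image rs a∈ = b , there b∈ , r′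

lo≢hi : (e : Edge n) → lo e ≢ hi e
lo≢hi e eq = ℕ.<-irrefl (cong toℕ eq) (lo<hi e)

edgeBetween : (u v : Fin n) → u ≢ v → ∃ λ e → e joins u and v
edgeBetween u v u≢v with Fin.<-cmp u v
... | tri< u<v _ _ = edge u v u<v , inj₁ (refl , refl)
... | tri≈ _ u≡v _ = contradiction u≡v u≢v
... | tri> _ _ v<u = edge v u v<u , inj₂ (refl , refl)

joins-ends : ∀ (e : Edge n) {u v x y} → e joins u and v → e joins x and y →
             (u ≡ x × v ≡ y) ⊎ (u ≡ y × v ≡ x)
joins-ends e (inj₁ (refl , refl)) (inj₁ (refl , refl)) = inj₁ (refl , refl)
joins-ends e (inj₁ (refl , refl)) (inj₂ (refl , refl)) = inj₂ (refl , refl)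
joins-ends e (inj₂ (refl , refl)) (inj₁ (refl , refl)) = inj₂ (refl , refl)
joins-ends e (inj₂ (refl , refl)) (inj₂ (refl , refl)) = inj₁ (refl , refl)

joins-map : (f : Fin m → Fin n) (e : Edge m) (e′ : Edge n) → ∀ {u v} →
            e′ joins f (lo e) and f (hi e) → e joins u and v → e′ joins f u and f v
joins-map f e e′ (inj₁ (p , q)) (inj₁ (refl , refl)) = inj₁ (p , q)
joins-map f e e′ (inj₁ (p , q)) (inj₂ (refl , refl)) = inj₂ (p , q)
joins-map f e e′ (inj₂ (p , q)) (inj₁ (refl , refl)) = inj₂ (p , q)
joins-map f e e′ (inj₂ (p , q)) (inj₂ (refl , refl)) = inj₁ (p , q)

edge-≡ : (e e′ : Edge n) → lo e ≡ lo e′ → hi e ≡ hi e′ → e ≡ e′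
edge-≡ (edge a b p) (edge .a .b q) refl refl = cong (edge a b) (ℕ.<-irrelevant p q)

joins-injective : (e e′ : Edge n) → e joins lo e′ and hi e′ → e ≡ e′
joins-injective e e′ (inj₁ (p , q)) = edge-≡ e e′ p q
joins-injective (edge a b p) (edge .b .a q) (inj₂ (refl , refl)) =
  contradiction q (ℕ.<-asym p)

endpoint⇒image : (f : Fin k → Fin n) (g : Edge k) (e : Edge n) → e joins f (lo g) and f (hi g) →
                 ∀ {i} → i endpointOf g → f i endpointOf e
endpoint⇒image f g e (inj₁ (p , q)) (inj₁ refl) = inj₁ (sym p)
endpoint⇒image f g e (inj₁ (p , q)) (inj₂ refl) = inj₂ (sym q)
endpoint⇒image f g e (inj₂ (p , q)) (inj₁ refl) = inj₂ (sym q)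
endpoint⇒image f g e (inj₂ (p , q)) (inj₂ refl) = inj₁ (sym p)

endpoint⇒preimage : (f : Fin k → Fin n) (g : Edge k) (e : Edge n) → e joins f (lo g) and f (hi g) →
                    ∀ {v} → v endpointOf e → ∃ λ i → i endpointOf g × f i ≡ v
endpoint⇒preimage f g e (inj₁ (p , q)) (inj₁ refl) = lo g , inj₁ refl , sym p
endpoint⇒preimage f g e (inj₁ (p , q)) (inj₂ refl) = hi g , inj₂ refl , sym q
endpoint⇒preimage f g e (inj₂ (p , q)) (inj₁ refl) = hi g , inj₂ refl , sym p
endpoint⇒preimage f g e (inj₂ (p , q)) (inj₂ refl) = lo g , inj₁ refl , sym q

_endpointOf?_ : (v : Fin n) (e : Edge n) → Dec (v endpointOf e)
v endpointOf? e = (v Fin.≟ lo e) ⊎-dec (v Fin.≟ hi e)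

-- Touched vertices and bounds on the number of edges.

_touches_ : Fin n → EdgeOrderedGraph n → Set
v touches H = Any (v endpointOf_) (edges H)

_touches?_ : (v : Fin n) (H : EdgeOrderedGraph n) → Dec (v touches H)
v touches? H = Any.any? (v endpointOf?_) (edges H)

untouched⇒∉ : (H : EdgeOrderedGraph n) → ∀ {e v} → ¬ (v touches H) → v endpointOf e → e ∉ edges H
untouched⇒∉ H v∉ v∈e e∈ = v∉ (Any.map (λ { refl → v∈e }) e∈)

ends-untouched : (H : EdgeOrderedGraph n) (e : Edge n) → ∀ {u v} → e joins u and v →
                 ¬ (u touches H) → ¬ (v touches H) → ∀ {w} → w endpointOf e → ¬ (w touches H)
ends-untouched H e (inj₁ (refl , refl)) u∉ v∉ (inj₁ refl) = u∉
ends-untouched H e (inj₁ (refl , refl)) u∉ v∉ (inj₂ refl) = v∉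
ends-untouched H e (inj₂ (refl , refl)) u∉ v∉ (inj₁ refl) = v∉
ends-untouched H e (inj₂ (refl , refl)) u∉ v∉ (inj₂ refl) = u∉

endpoints : List (Edge n) → List (Fin n)
endpoints []       = []
endpoints (e ∷ es) = lo e ∷ hi e ∷ endpoints es

length-endpoints : (es : List (Edge n)) → length (endpoints es) ≡ 2 * length es
length-endpoints []       = refl
length-endpoints (e ∷ es) =
  trans (cong (2 +_) (length-endpoints es)) (sym (ℕ.*-suc 2 (length es)))

endpoint⇒∈ : ∀ {v : Fin n} {es} → Any (v endpointOf_) es → v ∈ endpoints es
endpoint⇒∈ (here (inj₁ refl)) = here refl
endpoint⇒∈ (here (inj₂ refl)) = there (here refl)
endpoint⇒∈ (there v∈)         = there (there (endpoint⇒∈ v∈))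

untouchedVertex : (H : EdgeOrderedGraph n) → 2 * size H < n → ∃ λ v → ¬ (v touches H)
untouchedVertex H 2s<n
  with v , v∉ ← fresh (endpoints (edges H)) (subst (_< _) (sym (length-endpoints (edges H))) 2s<n)
  = v , v∉ ∘ endpoint⇒∈

-- The pair of ends codes the edges of `H` injectively in `Fin (a * b)`.
size-bound : ∀ {a b} (H : EdgeOrderedGraph n) →
             (∀ {e} → e ∈ edges H → toℕ (lo e) < a × toℕ (hi e) < b) → size H ≤ a * b
size-bound {n} {a} {b} H bound = Fin.injective⇒≤ code-injective
  where
  low : ∀ i → toℕ (lo (lookup (edges H) i)) < a
  low i = proj₁ (bound (∈-lookup i))

  high : ∀ i → toℕ (hi (lookup (edges H) i)) < b
  high i = proj₂ (bound (∈-lookup i))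

  code-injective : Injective _≡_ _≡_ (λ i → combine (fromℕ< (low i)) (fromℕ< (high i)))
  code-injective {i} {j} eq
    with p , q ← Fin.combine-injective (fromℕ< (low i)) (fromℕ< (high i)) (fromℕ< (low j)) (fromℕ< (high j)) eq
    = lookup-injective (distinct H) (edge-≡ _ _
        (Fin.toℕ-injective (Fin.fromℕ<-injective _ _ (low i) (low j) p))
        (Fin.toℕ-injective (Fin.fromℕ<-injective _ _ (high i) (high j) q)))

-- Monotonicity of copies and greedy saturation.

IsCopy-mono : (G : EdgeOrderedGraph k) (H H′ : EdgeOrderedGraph n) → ∀ {φ} →
              Sublist _≡_ (edges H) (edges H′) → IsCopy G H φ → IsCopy G H′ φ
IsCopy-mono G H H′ H⊆H′ (inj , sub) = inj , Sublist.trans (λ { r refl → r }) sub H⊆H′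

Sublist-refl : {A : Set} {xs : List A} → Sublist _≡_ xs xs
Sublist-refl = Sublist.refl refl

-- The vertices of G outside its edges can be placed anywhere.
contains : (G : EdgeOrderedGraph k) (H : EdgeOrderedGraph n) → k ≤ n → (φ : Fin k → Fin n) →
           InjectiveOn (_touches G) φ →
           Sublist (λ e e′ → e′ joins φ (lo e) and φ (hi e)) (edges G) (edges H) → H Contains G
contains G H k≤n φ inj sub
  with ψ , ψ-inj , agree ← extendInjection (_touches? G) φ inj k≤n
  = ψ , ψ-inj , Sublist-map∈ (λ {g} {e} g∈ → subst₂ (e joins_and_)
      (sym (agree (Any.map (λ { refl → inj₁ refl }) g∈)))
      (sym (agree (Any.map (λ { refl → inj₂ refl }) g∈)))) sub

-- First edges are inserted greedily while the graph stays `G`-free. Each of them was addable to the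
-- initial `H` already: a copy created over `H` survives when other edges are put between the new
-- first edge and `H`.
closure : (G : EdgeOrderedGraph k) (H : EdgeOrderedGraph n) → ¬ (H Contains G) →
          Σ (EdgeOrderedGraph n) λ Ĥ → Saturated G Ĥ ×
            (∀ {e} → e ∈ edges Ĥ →
               e ∈ edges H ⊎ (Σ (e ∉ edges H) λ e∉H → ¬ (insertFirst H e e∉H Contains G)))
-- No graph has more than `n * n` edges, so fuel and size together exceeding `n * n` means that the
-- fuel cannot run out.
closure {n = n} G H free = grow (suc (n * n)) H free (ℕ.m≤m+n _ _)
  where
  Addable : EdgeOrderedGraph n → Edge n → Set
  Addable H e = Σ (e ∉ edges H) λ e∉H → ¬ (insertFirst H e e∉H Contains G)

  addable? : ∀ H e → Dec (Addable H e)
  addable? H e with e ∈? edges H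
  ... | yes e∈H = no (λ (e∉H , _) → e∉H e∈H)
  ... | no e∉H  = map′ (e∉H ,_) (λ (_ , free′) → free′) (¬? (contains? (insertFirst H e e∉H) G))

  grow : ∀ fuel H → ¬ (H Contains G) → n * n < fuel + size H →
         Σ (EdgeOrderedGraph n) λ Ĥ → Saturated G Ĥ × (∀ {e} → e ∈ edges Ĥ → e ∈ edges H ⊎ Addable H e)
  grow zero    H free n*n< = contradiction (size≤n*n H) (ℕ.<⇒≱ n*n<)
  grow (suc fuel) H free n*n< with anyEdge? (addable? H)
  ... | no ¬addable = H , (free , λ e e∉H →
          decidable-stable (contains? (insertFirst H e e∉H) G) (λ free′ → ¬addable (e , e∉H , free′))) , inj₁
  ... | yes (e , e∉H , free′)
    with Ĥ , sat , new ← grow fuel (insertFirst H e e∉H) free′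
                           (subst (n * n <_) (sym (ℕ.+-suc fuel (size H))) n*n<)
    = Ĥ , sat , old ∘ new
    where
    old : ∀ {e′} → e′ ∈ (e ∷ edges H) ⊎ Addable (insertFirst H e e∉H) e′ → e′ ∈ edges H ⊎ Addable H e′
    old (inj₁ (here refl))  = inj₂ (e∉H , free′)
    old (inj₁ (there e′∈H)) = inj₁ e′∈H
    old {e′} (inj₂ (e′∉ , free″)) = inj₂ (e′∉ ∘ there , λ (φ , copy) →
      free″ (φ , IsCopy-mono G (insertFirst H e′ (e′∉ ∘ there)) (insertFirst (insertFirst H e e∉H) e′ e′∉)
                   (refl ∷ (e ∷ʳ Sublist-refl)) copy))

-- Moves the subgraph induced on P to other vertices.
module Relabelling {m n : ℕ} {P : Fin m → Set} (P? : Decidable P)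
                   (ρ : Fin m → Fin n) (ρ-inj : InjectiveOn P ρ) where

  Inside : Edge m → Set
  Inside e = P (lo e) × P (hi e)

  inside? : ∀ e → Dec (Inside e)
  inside? e = P? (lo e) ×-dec P? (hi e)

  imageEdge : ∀ e → Inside e → ∃ λ e′ → e′ joins ρ (lo e) and ρ (hi e)
  imageEdge e (p , q) = edgeBetween (ρ (lo e)) (ρ (hi e)) (lo≢hi e ∘ ρ-inj p q)

  relabel : List (Edge m) → List (Edge n)
  relabel [] = []
  relabel (e ∷ es) with inside? e
  ... | yes p = proj₁ (imageEdge e p) ∷ relabel es
  ... | no _  = relabel es

  ∈-relabel⁻ : ∀ es {e′} → e′ ∈ relabel es →
               ∃ λ e → e ∈ es × Inside e × e′ joins ρ (lo e) and ρ (hi e)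
  ∈-relabel⁻ (e ∷ es) e′∈ with inside? e
  ∈-relabel⁻ (e ∷ es) (here refl) | yes p = e , here refl , p , proj₂ (imageEdge e p)
  ∈-relabel⁻ (e ∷ es) (there e′∈) | yes p with d , d∈ , rest ← ∈-relabel⁻ es e′∈ = d , there d∈ , rest
  ∈-relabel⁻ (e ∷ es) e′∈         | no _  with d , d∈ , rest ← ∈-relabel⁻ es e′∈ = d , there d∈ , rest

  relabelled-≡ : ∀ e d e′ → Inside e → Inside d →
                 e′ joins ρ (lo e) and ρ (hi e) → e′ joins ρ (lo d) and ρ (hi d) → e ≡ d
  relabelled-≡ e d e′ (p , q) (r , s) je jd with joins-ends e′ je jd
  ... | inj₁ (x , y) = joins-injective e d (inj₁ (ρ-inj p r x , ρ-inj q s y))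
  ... | inj₂ (x , y) = joins-injective e d (inj₂ (ρ-inj p s x , ρ-inj q r y))

  relabel-unique : ∀ {es} → Unique es → Unique (relabel es)
  relabel-unique {[]} [] = []
  relabel-unique {e ∷ es} (e∉ ∷ u) with inside? e
  ... | no _  = relabel-unique u
  ... | yes p = All.tabulate (λ { {d′} d′∈ refl → clash d′ d′∈ (proj₂ (imageEdge e p)) }) ∷ relabel-unique u
    where
    clash : ∀ d′ → d′ ∈ relabel es → ¬ (d′ joins ρ (lo e) and ρ (hi e))
    clash d′ d′∈ je with d , d∈ , q , jd ← ∈-relabel⁻ es d′∈ =
      All.lookup e∉ d∈ (relabelled-≡ e d d′ p q je jd)

  relabelGraph : EdgeOrderedGraph m → EdgeOrderedGraph n
  relabelGraph H = mkGraph (relabel (edges H)) (relabel-unique (distinct H))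

  -- A copy inside `P` loses no edge: the ends of each edge it uses are values of `φ`, so `relabel`
  -- keeps that edge.
  relabel-sublist⁺ : ∀ {gs es} (φ : Fin k → Fin m) → (∀ i → P (φ i)) →
    Sublist (λ g e → e joins φ (lo g) and φ (hi g)) gs es →
    Sublist (λ g e → e joins ρ (φ (lo g)) and ρ (φ (hi g))) gs (relabel es)
  relabel-sublist⁺ φ inP [] = []
  relabel-sublist⁺ φ inP (e ∷ʳ sub) with inside? e
  ... | yes p = _ ∷ʳ relabel-sublist⁺ φ inP sub
  ... | no _  = relabel-sublist⁺ φ inP sub
  relabel-sublist⁺ {es = e ∷ _} φ inP (r ∷ sub) with inside? e
  ... | yes p = joins-map ρ e (proj₁ (imageEdge e p)) (proj₂ (imageEdge e p)) r ∷ relabel-sublist⁺ φ inP sub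
  ... | no ¬p = contradiction (inside e r) ¬p
    where
    inside : ∀ d {i j} → d joins φ i and φ j → Inside d
    inside d (inj₁ (refl , refl)) = inP _ , inP _
    inside d (inj₂ (refl , refl)) = inP _ , inP _

  relabel-copy⁺ : (G : EdgeOrderedGraph k) (H : EdgeOrderedGraph m) {φ : Fin k → Fin m} → (∀ i → P (φ i)) →
                  IsCopy G H φ → IsCopy G (relabelGraph H) (ρ ∘ φ)
  relabel-copy⁺ G H {φ} inP (inj , sub) = inj ∘ ρ-inj (inP _) (inP _) , relabel-sublist⁺ φ inP sub

  module _ (junk : Fin m) where

    unlabel : Fin n → Fin m
    unlabel y with Fin.any? (λ x → P? x ×-dec (ρ x Fin.≟ y))
    ... | yes (x , _) = x
    ... | no _        = junk

    unlabel-ρ : ∀ {x} → P x → unlabel (ρ x) ≡ x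
    unlabel-ρ {x} p with Fin.any? (λ z → P? z ×-dec (ρ z Fin.≟ ρ x))
    ... | yes (z , q , eq) = ρ-inj q p eq
    ... | no ¬∃            = contradiction (x , p , refl) ¬∃

    relabel-sublist⁻ : ∀ {gs} es (ψ : Fin k → Fin n) →
      Sublist (λ g e → e joins ψ (lo g) and ψ (hi g)) gs (relabel es) →
      Sublist (λ g e → e joins unlabel (ψ (lo g)) and unlabel (ψ (hi g))) gs es
    relabel-sublist⁻ [] ψ [] = []
    relabel-sublist⁻ (e ∷ es) ψ sub with inside? e
    relabel-sublist⁻ (e ∷ es) ψ sub        | no _ = e ∷ʳ relabel-sublist⁻ es ψ sub
    relabel-sublist⁻ (e ∷ es) ψ (_ ∷ʳ sub) | yes p = e ∷ʳ relabel-sublist⁻ es ψ sub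
    relabel-sublist⁻ (e ∷ es) ψ (r ∷ sub)  | yes p@(p₁ , p₂) =
      back (joins-ends (proj₁ (imageEdge e p)) (proj₂ (imageEdge e p)) r) ∷ relabel-sublist⁻ es ψ sub
      where
      back : ∀ {u v} → (ρ (lo e) ≡ u × ρ (hi e) ≡ v) ⊎ (ρ (lo e) ≡ v × ρ (hi e) ≡ u) →
             e joins unlabel u and unlabel v
      back (inj₁ (refl , refl)) = inj₁ (sym (unlabel-ρ p₁) , sym (unlabel-ρ p₂))
      back (inj₂ (refl , refl)) = inj₂ (sym (unlabel-ρ p₁) , sym (unlabel-ρ p₂))

    -- A copy is pulled back along `unlabel`. Touched vertices of `G` go to ends of relabelled
    -- edges, where `ρ` undoes `unlabel`, so injectivity survives on them. The other vertices may
    -- collide at `junk`; `contains` places them anew, which takes `k ≤ m`.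
    relabel-free : (G : EdgeOrderedGraph k) (H : EdgeOrderedGraph m) → k ≤ m →
                   ¬ (H Contains G) → ¬ (relabelGraph H Contains G)
    relabel-free G H k≤m free (ψ , inj , sub) = free (contains G H k≤m (unlabel ∘ ψ)
        (λ p q eq → inj (trans (sym (labelled p)) (trans (cong ρ eq) (labelled q))))
        (relabel-sublist⁻ (edges H) ψ sub))
      where
      labelled-end : ∀ {e : Edge n} {d : Edge m} {v} → Inside d → e joins ρ (lo d) and ρ (hi d) → v endpointOf e →
                     ρ (unlabel v) ≡ v
      labelled-end (p , q) (inj₁ (refl , refl)) (inj₁ refl) = cong ρ (unlabel-ρ p)
      labelled-end (p , q) (inj₁ (refl , refl)) (inj₂ refl) = cong ρ (unlabel-ρ q)
      labelled-end (p , q) (inj₂ (refl , refl)) (inj₁ refl) = cong ρ (unlabel-ρ q)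
      labelled-end (p , q) (inj₂ (refl , refl)) (inj₂ refl) = cong ρ (unlabel-ρ p)

      labelled : ∀ {i} → i touches G → ρ (unlabel (ψ i)) ≡ ψ i
      labelled i∈ with g , g∈ , i∈g ← find i∈
        with e , e∈ , j ← Sublist-image sub g∈
        with d , _ , ins , jd ← ∈-relabel⁻ (edges H) e∈
        = labelled-end {e = e} {d = d} ins jd (endpoint⇒image ψ g e j i∈g)

-- Placing listed vertices on an initial segment.

module _ {m : ℕ} (W : List (Fin m)) (|W|≤n : length W ≤ n) (junk : Fin n) where

  -- `W` may repeat a vertex. The index is the one found by `∈ᶠ?`, so it depends on the vertex alone
  -- and not on a given membership proof.
  position : Fin m → Fin n
  position v with v ∈ᶠ? W
  ... | yes v∈W = inject≤ (index v∈W) |W|≤n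
  ... | no _    = junk

  position-index : ∀ {v} → v ∈ W → ∃ λ (i : Fin (length W)) → lookup W i ≡ v × position v ≡ inject≤ i |W|≤n
  position-index {v} v∈ with v ∈ᶠ? W
  ... | yes v∈W = index v∈W , sym (lookup-index v∈W) , refl
  ... | no v∉W  = contradiction v∈ v∉W

  position-injective : InjectiveOn (_∈ W) position
  position-injective u∈ v∈ eq
    with i , refl , p ← position-index u∈ | j , refl , q ← position-index v∈
    = cong (lookup W) (Fin.inject≤-injective |W|≤n |W|≤n i j (trans (sym p) (trans eq q)))

  position-< : ∀ {v} → v ∈ W → toℕ (position v) < length W
  position-< v∈ with i , _ , p ← position-index v∈ =
    subst (_< length W) (sym (trans (cong toℕ p) (Fin.toℕ-inject≤ i |W|≤n))) (Fin.toℕ<n i)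

-- Copies of `G` against copies of `G` without its minimal edge.

module MinimalEdgeRemoved {k : ℕ} (e₀ : Edge k) (es : List (Edge k))
                          (e₀∉es : All (e₀ ≢_) es) (unique : Unique es) where

  G G⁻ : EdgeOrderedGraph k
  G  = mkGraph (e₀ ∷ es) (e₀∉es ∷ unique)
  G⁻ = mkGraph es unique

  -- The ends of `e₀` are exempt: when `e₀` is isolated, no edge of `G⁻` meets them, so their images
  -- are free to move.
  Avoids : (Fin k → Fin n) → Fin n → Set
  Avoids φ v = ∀ i → ¬ (i endpointOf e₀) → φ i ≢ v

  -- The inserted edge comes first, so a copy of `G` either skips it and lies in `H`, or uses it as
  -- the image of `e₀`.
  detach : (H : EdgeOrderedGraph n) → ¬ (H Contains G) → ∀ {e} (e∉H : e ∉ edges H) →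
           insertFirst H e e∉H Contains G →
           ∃ λ φ → IsCopy G⁻ H φ × e joins φ (lo e₀) and φ (hi e₀)
  detach H free e∉H (φ , inj , _ ∷ʳ sub) = contradiction (φ , (λ {x} {y} → inj {x} {y}) , sub) free
  detach H free e∉H (φ , inj , r ∷ sub)  = φ , ((λ {x} {y} → inj {x} {y}) , sub) , r

  avoids-ends : ∀ (φ : Fin k → Fin n) e → Injective _≡_ _≡_ φ → e joins φ (lo e₀) and φ (hi e₀) →
                ∀ {v} → v endpointOf e → Avoids φ v
  avoids-ends φ e inj r v∈e i i∉e₀ φi≡v with j , j∈e₀ , φj≡v ← endpoint⇒preimage φ e₀ e r v∈e =
    i∉e₀ (subst (_endpointOf e₀) (inj (trans φj≡v (sym φi≡v))) j∈e₀)

  -- The ends of `e₀` are redirected to those of `e`. Avoidance keeps the map injective, and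
  -- isolation keeps the change away from the edges of `G⁻`.
  attach : Isolated G e₀ → (H : EdgeOrderedGraph n) → ∀ {e} (e∉H : e ∉ edges H) φ → IsCopy G⁻ H φ →
           Avoids φ (lo e) → Avoids φ (hi e) → insertFirst H e e∉H Contains G
  attach {n} iso H {e} e∉H φ (inj , sub) avoids-lo avoids-hi =
    χ , χ-injective , inj₁ (sym χ-lo , sym χ-hi) ∷ Sublist-map∈ (λ {_} {d} → kept d) sub
    where
    φ′ χ : Fin k → Fin n
    φ′ = updateAt φ (lo e₀) (const (lo e))
    χ  = updateAt φ′ (hi e₀) (const (hi e))

    χ-hi : χ (hi e₀) ≡ hi e
    χ-hi = updateAt-updates (hi e₀) φ′

    χ-lo : χ (lo e₀) ≡ lo e
    χ-lo = trans (updateAt-minimal (lo e₀) (hi e₀) φ′ (lo≢hi e₀)) (updateAt-updates (lo e₀) φ)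

    χ-other : ∀ i → ¬ (i endpointOf e₀) → χ i ≡ φ i
    χ-other i i∉ = trans (updateAt-minimal i (hi e₀) φ′ (i∉ ∘ inj₂)) (updateAt-minimal i (lo e₀) φ (i∉ ∘ inj₁))

    other-end : ∀ {i j} → ¬ (i endpointOf e₀) → j endpointOf e₀ → χ i ≢ χ j
    other-end {i} i∉ (inj₁ refl) eq = avoids-lo i i∉ (trans (sym (χ-other i i∉)) (trans eq χ-lo))
    other-end {i} i∉ (inj₂ refl) eq = avoids-hi i i∉ (trans (sym (χ-other i i∉)) (trans eq χ-hi))

    χ-injective : Injective _≡_ _≡_ χ
    χ-injective {x} {y} eq with x endpointOf? e₀ | y endpointOf? e₀
    ... | no x∉ | no y∉ = inj (trans (sym (χ-other x x∉)) (trans eq (χ-other y y∉)))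
    ... | no x∉ | yes y∈ = contradiction eq (other-end x∉ y∈)
    ... | yes x∈ | no y∉ = contradiction (sym eq) (other-end y∉ x∈)
    ... | yes (inj₁ refl) | yes (inj₁ refl) = refl
    ... | yes (inj₂ refl) | yes (inj₂ refl) = refl
    ... | yes (inj₁ refl) | yes (inj₂ refl) = contradiction (trans (sym χ-lo) (trans eq χ-hi)) (lo≢hi e)
    ... | yes (inj₂ refl) | yes (inj₁ refl) = contradiction (trans (sym χ-lo) (trans (sym eq) χ-hi)) (lo≢hi e)

    kept : ∀ {g} d → g ∈ es → d joins φ (lo g) and φ (hi g) → d joins χ (lo g) and χ (hi g)
    kept {g} d g∈ = subst₂ (d joins_and_) (sym (off (inj₁ refl))) (sym (off (inj₂ refl)))
      where
      off : ∀ {i} → i endpointOf g → χ i ≡ φ i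
      off {i} i∈g = χ-other i (λ i∈e₀ → iso g (there g∈) (≢-sym (All.lookup e₀∉es g∈)) i i∈e₀ i∈g)

  -- Lower bound when `e₀` is not isolated.

  -- Inserting the edge `uv` creates a copy with `e₀` placed on it. An edge `g` of `G` meeting `e₀`
  -- would have its image in `H`, touching `u` or `v`.
  untouched-pair⇒isolated : (H : EdgeOrderedGraph n) → Saturated G H → ∀ {u v} → u ≢ v →
                            ¬ (u touches H) → ¬ (v touches H) → Isolated G e₀
  untouched-pair⇒isolated H _ _ _ _ .e₀ (here refl) e₀≢e₀ _ _ _ = e₀≢e₀ refl
  untouched-pair⇒isolated H (free , sat) {u} {v} u≢v u∉ v∉ g (there g∈) _ i i∈e₀ i∈g
    with e , e-uv ← edgeBetween u v u≢v
    with e∉ ← untouched⇒∉ H (ends-untouched H e e-uv u∉ v∉ (inj₁ refl)) (inj₁ refl)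
    with φ , (_ , sub) , r ← detach H free e∉ (sat e e∉)
    with d , d∈ , s ← Sublist-image sub g∈
    = ends-untouched H e e-uv u∉ v∉ (endpoint⇒image φ e₀ e r i∈e₀)
        (Any.map (λ { refl → endpoint⇒image φ g d s i∈g }) d∈)

  order≤1+2*size : ¬ Isolated G e₀ → (H : EdgeOrderedGraph n) → Saturated G H → n ≤ suc (2 * size H)
  order≤1+2*size {n} ¬iso H sat = ℕ.≮⇒≥ λ 2s+1<n →
    let v , v∉ = untouchedVertex H (ℕ.<-trans (ℕ.n<1+n _) 2s+1<n)
        w , w∉ = fresh (v ∷ endpoints (edges H))
                   (subst (_< n) (cong suc (sym (length-endpoints (edges H)))) 2s+1<n)
    in ¬iso (untouched-pair⇒isolated H sat (w∉ ∘ here ∘ sym) v∉ (w∉ ∘ there ∘ endpoint⇒∈))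

  -- Room for k + 1 copies of `G⁻` on k vertices each.
  core : ℕ
  core = suc k * k

  -- Sparse saturated graphs when `e₀` is isolated.

  module _ (iso : Isolated G e₀) where

    -- An edge of the closure is relabelled or was addable to the relabelled graph. By `attach`, an
    -- addable edge has, for each relabelled copy of `G⁻` from `P`, an end that the copy does not
    -- avoid.
    relabelled-closure : {P : Fin m → Set} (P? : Decidable P) (ρ : Fin m → Fin n) → InjectiveOn P ρ →
      k ≤ m → (H : EdgeOrderedGraph m) → ¬ (H Contains G) →
      Σ (EdgeOrderedGraph n) λ Ĥ → Saturated G Ĥ × (∀ {e} → e ∈ edges Ĥ →
        (∃₂ λ x y → P x × P y × lo e ≡ ρ x × hi e ≡ ρ y) ⊎
        (∀ φ → IsCopy G⁻ H φ → (∀ i → P (φ i)) → Avoids (ρ ∘ φ) (lo e) → ¬ Avoids (ρ ∘ φ) (hi e)))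
    relabelled-closure {P = P} P? ρ ρ-inj k≤m H free =
      let Ĥ , sat , origin = closure G (R.relabelGraph H) (R.relabel-free (inject≤ (lo e₀) k≤m) G H k≤m free)
      in Ĥ , sat , λ {e} e∈ → classify e (origin e∈)
      where
      module R = Relabelling P? ρ ρ-inj

      classify : ∀ e →
        e ∈ edges (R.relabelGraph H) ⊎
        (Σ (e ∉ edges (R.relabelGraph H)) λ e∉ → ¬ (insertFirst (R.relabelGraph H) e e∉ Contains G)) →
        (∃₂ λ x y → P x × P y × lo e ≡ ρ x × hi e ≡ ρ y) ⊎
        (∀ φ → IsCopy G⁻ H φ → (∀ i → P (φ i)) → Avoids (ρ ∘ φ) (lo e) → ¬ Avoids (ρ ∘ φ) (hi e))
      classify e (inj₁ e∈) with R.∈-relabel⁻ (edges H) e∈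
      ... | d , _ , (p , q) , inj₁ (x , y) = inj₁ (lo d , hi d , p , q , x , y)
      ... | d , _ , (p , q) , inj₂ (x , y) = inj₁ (hi d , lo d , q , p , x , y)
      classify e (inj₂ (e∉ , free′)) = inj₂ λ φ copy inP a b →
        free′ (attach iso (R.relabelGraph H) e∉ (ρ ∘ φ) (R.relabel-copy⁺ G⁻ H inP copy) a b)

    -- The closure starts from `G⁻` on the first k vertices. An edge with both ends beyond them
    -- would be avoided by that copy, so every edge has its lower end among them.
    linear-saturated : k ≤ n → Σ (EdgeOrderedGraph n) λ Ĥ → Saturated G Ĥ × size Ĥ ≤ k * n
    linear-saturated {n} k≤n =
      let Ĥ , sat , origin = relabelled-closure {P = λ _ → ⊤} (λ _ → yes tt) ρ
                               (λ _ _ → Fin.inject≤-injective k≤n k≤n _ _) ℕ.≤-refl G⁻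
                               -- `G⁻` has one edge fewer than `G`, hence is `G`-free.
                               (λ (_ , _ , sub) → ℕ.<-irrefl refl (Sublist.length-mono-≤ sub))
      in Ĥ , sat , size-bound Ĥ (λ {e} e∈ → low e (origin e∈) , Fin.toℕ<n (hi e))
      where
      ρ : Fin k → Fin n
      ρ i = inject≤ i k≤n

      ρ-< : ∀ i → toℕ (ρ i) < k
      ρ-< i = subst (_< k) (sym (Fin.toℕ-inject≤ i k≤n)) (Fin.toℕ<n i)

      avoids : ∀ {v} → k ≤ toℕ v → Avoids ρ v
      avoids k≤v i _ refl = ℕ.<⇒≱ (ρ-< i) k≤v

      low : ∀ e →
        (∃₂ λ x y → ⊤ × ⊤ × lo e ≡ ρ x × hi e ≡ ρ y) ⊎
        (∀ φ → IsCopy G⁻ G⁻ φ → (∀ (i : Fin k) → ⊤) → Avoids (ρ ∘ φ) (lo e) → ¬ Avoids (ρ ∘ φ) (hi e)) →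
        toℕ (lo e) < k
      low e (inj₁ (x , _ , _ , _ , refl , _)) = ρ-< x
      low e (inj₂ blocked) = ℕ.≰⇒> λ k≤lo →
        blocked id (id , Sublist.refl (inj₁ (refl , refl))) _
          (avoids k≤lo) (avoids (ℕ.<⇒≤ (ℕ.≤-<-trans k≤lo (lo<hi e))))

    -- The edge `xu` is missing since `u` is untouched. Inserting it creates a copy with `e₀` on
    -- `xu`, whose remaining vertices avoid both ends.
    copyAvoidingBoth : (H : EdgeOrderedGraph m) → Saturated G H → ∀ {u} → ¬ (u touches H) →
                       ∀ {x} → x ≢ u → ∃ λ φ → IsCopy G⁻ H φ × Avoids φ x × Avoids φ u
    copyAvoidingBoth H (free , sat) {u} u∉ {x} x≢u
      with edgeBetween x u x≢u
    ... | e , inj₁ (refl , refl)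
      with e∉ ← untouched⇒∉ H u∉ (inj₂ refl)
      with φ , copy , r ← detach H free e∉ (sat e e∉)
      = φ , copy , avoids-ends φ e (proj₁ copy) r (inj₁ refl) , avoids-ends φ e (proj₁ copy) r (inj₂ refl)
    ... | e , inj₂ (refl , refl)
      with e∉ ← untouched⇒∉ H u∉ (inj₁ refl)
      with φ , copy , r ← detach H free e∉ (sat e e∉)
      = φ , copy , avoids-ends φ e (proj₁ copy) r (inj₂ refl) , avoids-ends φ e (proj₁ copy) r (inj₁ refl)

    copyAvoiding : k ≤ m → (H : EdgeOrderedGraph m) → Saturated G H → ∀ {u} → ¬ (u touches H) →
                   ∀ x → ∃ λ φ → IsCopy G⁻ H φ × Avoids φ x
    copyAvoiding {m} k≤m H sat {u} u∉ x with x Fin.≟ u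
    ... | no x≢u with φ , copy , avoids , _ ← copyAvoidingBoth H sat u∉ x≢u = φ , copy , avoids
    -- For `x` equal to `u` a partner other than `u` is needed: the two ends of `e₀` give distinct
    -- vertices of `Fin m`, so one of them serves.
    ... | yes refl with inject≤ (lo e₀) k≤m Fin.≟ x
    ...   | no y≢x with φ , copy , _ , avoids ← copyAvoidingBoth H sat u∉ y≢x = φ , copy , avoids
    ...   | yes y≡x with φ , copy , _ , avoids ← copyAvoidingBoth H sat u∉ {inject≤ (hi e₀) k≤m}
                           (λ z≡x → lo≢hi e₀ (Fin.inject≤-injective k≤m k≤m _ _ (trans y≡x (sym z≡x))))
          = φ , copy , avoids

    -- k + 1 copies of G − e₀ suffice to keep the property that every vertex is avoided by a copy:
    -- one copy φ₀, and for each of its vertices another copy avoiding that vertex.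
    bounded-saturated : k ≤ m → (H : EdgeOrderedGraph m) → Saturated G H → ∀ {u} → ¬ (u touches H) →
                        core ≤ n → Σ (EdgeOrderedGraph n) λ Ĥ → Saturated G Ĥ × size Ĥ ≤ core * core
    bounded-saturated {m} {n} k≤m H sat u∉ core≤n =
      let Ĥ , sat′ , origin = relabelled-closure (_∈ᶠ? W) ρ ρ-inj k≤m H (proj₁ sat)
      in Ĥ , sat′ , size-bound Ĥ (λ {e} e∈ →
           let high = bound e (origin e∈) in ℕ.<-trans (lo<hi e) high , high)
      where
      avoiding : ∀ x → ∃ λ φ → IsCopy G⁻ H φ × Avoids φ x
      avoiding = copyAvoiding k≤m H sat u∉

      φ₀ : Fin k → Fin m
      -- Any copy of `G⁻` can start the family; this vertex only serves to obtain one.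
      φ₀ = proj₁ (avoiding (inject≤ (lo e₀) k≤m))

      Φ : Fin (suc k) → Fin k → Fin m
      Φ zero    = φ₀
      Φ (suc j) = proj₁ (avoiding (φ₀ j))

      Φ-copy : ∀ j → IsCopy G⁻ H (Φ j)
      Φ-copy zero    = proj₁ (proj₂ (avoiding (inject≤ (lo e₀) k≤m)))
      Φ-copy (suc j) = proj₁ (proj₂ (avoiding (φ₀ j)))

      vertex : Fin core → Fin m
      vertex p = let j , i = remQuot k p in Φ j i

      W : List (Fin m)
      W = tabulate vertex

      Φ∈W : ∀ j i → Φ j i ∈ W
      Φ∈W j i = subst (λ (j , i) → Φ j i ∈ W) (Fin.remQuot-combine j i) (∈-tabulate⁺ {f = vertex} (combine j i))

      |W| : length W ≡ core
      |W| = length-tabulate vertex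

      |W|≤n : length W ≤ n
      |W|≤n = subst (_≤ n) (sym |W|) core≤n

      junk : Fin n
      junk = inject≤ (lo e₀) (ℕ.≤-trans (ℕ.m≤m+n k (k * k)) core≤n)

      ρ : Fin m → Fin n
      ρ = position W |W|≤n junk

      ρ-inj : InjectiveOn (_∈ W) ρ
      ρ-inj = position-injective W |W|≤n junk

      ρ-< : ∀ {v} → v ∈ W → toℕ (ρ v) < core
      ρ-< {v} v∈ = subst (toℕ (ρ v) <_) |W| (position-< W |W|≤n junk v∈)

      avoids-high : ∀ j {v} → core ≤ toℕ v → Avoids (ρ ∘ Φ j) v
      avoids-high j high i _ refl = ℕ.<⇒≱ (ρ-< (Φ∈W j i)) high

      avoidingCopy : ∀ v → ∃ λ j → Avoids (ρ ∘ Φ j) v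
      -- If `φ₀` hits `v` at `j`, the copy chosen against `φ₀ j` avoids `v`, as `ρ` is injective on
      -- `W`; otherwise `φ₀` itself avoids `v`.
      avoidingCopy v with Fin.any? (λ i → ρ (φ₀ i) Fin.≟ v)
      ... | yes (j , refl) = suc j , λ i i∉ eq →
              proj₂ (proj₂ (avoiding (φ₀ j))) i i∉ (ρ-inj (Φ∈W (suc j) i) (Φ∈W zero j) eq)
      ... | no ¬∃ = zero , λ i _ eq → ¬∃ (i , eq)

      bound : ∀ e →
        (∃₂ λ x y → x ∈ W × y ∈ W × lo e ≡ ρ x × hi e ≡ ρ y) ⊎
        (∀ φ → IsCopy G⁻ H φ → (∀ i → φ i ∈ W) → Avoids (ρ ∘ φ) (lo e) → ¬ Avoids (ρ ∘ φ) (hi e)) →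
        toℕ (hi e) < core
      bound e (inj₁ (_ , y , _ , y∈ , _ , eq)) = subst (λ v → toℕ v < core) (sym eq) (ρ-< y∈)
      -- All the copies lie below `core`, so the copy avoiding `lo e` would avoid a high `hi e` as
      -- well.
      bound e (inj₂ blocked) = ℕ.≰⇒> λ high →
        let j , avoids-lo = avoidingCopy (lo e)
        in blocked (Φ j) (Φ-copy j) (Φ∈W j) avoids-lo (avoids-high j high)

-- From saturated graphs to the growth of the saturation number.

theorem5 : ∀ {k : ℕ} (G : EdgeOrderedGraph k) (e₀ : Edge k) (min : MinimalEdge G e₀) →
    (Isolated G e₀ → (satₘ G min ∈O (λ _ → 1)) ⊎ (satₘ G min ∈Θ (λ n → n))) ×
    (¬ Isolated G e₀ → satₘ G min ∈Ω (λ n → n))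
theorem5 {k} (mkGraph (e₀ ∷ es) (e₀∉es ∷ unique)) .e₀ refl = isolatedCase , nonIsolatedCase
  where
  open MinimalEdgeRemoved e₀ es e₀∉es unique

  sat : ℕ → ℕ
  sat = satₘ G refl

  optimal : ∀ n → Σ (EdgeOrderedGraph n) λ H → Saturated G H × size H ≡ sat n
  optimal n = proj₁ (satₘ-isMinimum G refl n)

  sat≤ : ∀ {n c} → (Σ (EdgeOrderedGraph n) λ H → Saturated G H × size H ≤ c) → sat n ≤ c
  sat≤ {n} (H , H-sat , size≤) = ℕ.≤-trans (proj₂ (satₘ-isMinimum G refl n) (size H) (H , H-sat , refl)) size≤

  nonIsolatedCase : ¬ Isolated G e₀ → sat ∈Ω (λ n → n)
  -- From n ≥ 2 and n ≤ 1 + 2s follows s ≥ 1, so the summand 1 is absorbed into a third s.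
  nonIsolatedCase ¬iso = 3 , 2 , λ n 2≤n → linear (sat n) 2≤n (order≤sat n)
    where
    order≤sat : ∀ n → n ≤ suc (2 * sat n)
    order≤sat n with H , H-sat , eq ← optimal n =
      subst (λ s → n ≤ suc (2 * s)) eq (order≤1+2*size ¬iso H H-sat)

    linear : ∀ {n} s → 2 ≤ n → n ≤ suc (2 * s) → n ≤ 3 * s
    linear zero    2≤n n≤1 = contradiction (ℕ.≤-trans 2≤n n≤1) (ℕ.<⇒≱ ℕ.≤-refl)
    linear (suc s) _   n≤  = ℕ.≤-trans n≤ (ℕ.+-monoˡ-≤ (2 * suc s) (s≤s z≤n))

  -- The first summand puts `N` above twice the bound `core * core`; the second makes `core`
  -- vertices fit into `N`.
  N : ℕ
  N = suc (2 * (core * core)) + core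

  core≤N : core ≤ N
  core≤N = ℕ.m≤n+m core (suc (2 * (core * core)))

  k≤N : k ≤ N
  k≤N = ℕ.≤-trans (ℕ.m≤m+n k (k * k)) core≤N

  -- An optimal graph on m vertices with fewer than m / 2 edges has an untouched vertex, and the
  -- bound drawn from it does not depend on m.
  sparse⇒bounded : Isolated G e₀ → ∀ {m n} → k ≤ m → core ≤ n → 2 * sat m < m → sat n ≤ core * core
  sparse⇒bounded iso {m} k≤m core≤n sparse
    with H , H-sat , eq ← optimal m
    with u , u∉ ← untouchedVertex H (subst (λ s → 2 * s < m) (sym eq) sparse)
    = sat≤ (bounded-saturated iso k≤m H H-sat u∉ core≤n)

  -- Comparing 2 sat(N) with N decides the dichotomy: N > 2 core², so N is sparse as soon as any m ≥ k is.
  isolatedCase : Isolated G e₀ → (sat ∈O (λ _ → 1)) ⊎ (sat ∈Θ (λ n → n))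
  isolatedCase iso with 2 * sat N ℕ.<? N
  ... | yes sparse = inj₁ (core * core , core , λ n core≤n →
          subst (sat n ≤_) (sym (ℕ.*-identityʳ (core * core))) (sparse⇒bounded iso k≤N core≤n sparse))
  ... | no ¬sparse = inj₂ (
          (k , k , λ n k≤n → sat≤ (linear-saturated iso k≤n)) ,
          (2 , k , λ n k≤n → ℕ.≮⇒≥ λ sparse → ¬sparse
            (s≤s (ℕ.≤-trans (ℕ.*-monoʳ-≤ 2 (sparse⇒bounded iso k≤n core≤N sparse)) (ℕ.m≤m+n _ core)))))
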